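{- Let $m\geq 1$ and $n\geq m$ be integers. Let $G$ be an edge-colored complete graph on $n$ vertices obtained as follows: $G$ contains a copy of $T_{n-m+1}$ on some $n-m+1$ of its vertices, and every edge of $G$ not in $T_{n-m+1}$ receives a unique color (a color used on no other edge of $G$). Then $$c(G)= mn-\binom{m+1}{2},\qquad e(G)+c(G)=\binom{n}{2}+mn-\binom{m+1}{2},$$ and $G$ does not contain a proper $mK_3$. Moreover, if $m>1$ and $n\geq 5m$, then $$\binom{n}{2}+mn-\binom{m+1}{2} > \binom{n}{2}+n+6m-7.$$ Consequently, the assertion "every edge-colored graph $H$ on $n\ge 5m$ vertices with $e(H)+c(H)\ge \binom{n+1}{2}+6m-6$ contains a proper $mK_3$" is false.
   Context: All graphs are finite and simple. An edge-colored graph is a graph $G$ together with an arbitrary map $C:E(G)\to\mathbb{N}$ (not necessarily a proper coloring). $e(G)=|E(G)|$ is the number of edges, and $c(G)=|C(E(G))|$ is the number of distinct colors appearing on the edges of $G$. An edge-colored graph is rainbow if no two of its edges share the same color. A proper $mK_3$ is a union of $m$ pairwise vertex-disjoint rainbow triangles (each triangle is rainbow; different triangles may share colors). For $N\geq 1$, $T_N$ denotes the edge-colored complete graph with vertex set $\{v_1,\dots,v_N\}$ and coloring $C(v_iv_j)=i$ for $1\leq i<j\leq N$ (so it uses the $N-1$ colors $1,\dots,N-1$). -}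

module Defs where

open import Data.Fin.Base using (Fin; toℕ)
open import Data.Fin.Properties using (_<?_) renaming (_≟_ to _≟ᶠ_)
open import Data.List.Base using (List; []; _∷_; map; filter; length; deduplicate; allFin; cartesianProduct)
open import Data.List.Relation.Binary.Disjoint.Propositional using (Disjoint)
open import Data.Nat.Base using (ℕ; suc; _⊓_; _∸_)
open import Data.Nat.Properties using (⊓-comm; _≟_)
open import Data.Product.Base using (Σ-syntax; ∃₂; _×_; _,_; uncurry)
open import Data.Sum.Base using (_⊎_)
open import Function.Definitions using (Injective)
open import Level using (0ℓ)
open import Relation.Binary.Core using (Rel)
open import Relation.Binary.Definitions using (Decidable; Symmetric; Irreflexive)
open import Relation.Binary.PropositionalEquality using (_≡_; _≢_; cong; ≢-sym)
open import Relation.Nullary using (¬_)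
open import Relation.Nullary.Decidable using (¬?; _×-dec_)

-- A colouring of the edge set is given as a symmetric function on all pairs of
-- vertices; its values on non-adjacent pairs are never used below.
record EdgeColouredGraph (n : ℕ) : Set₁ where
  field
    Adj        : Rel (Fin n) 0ℓ
    adj?       : Decidable Adj
    adj-sym    : Symmetric Adj
    adj-irrefl : Irreflexive _≡_ Adj
    colour     : Fin n → Fin n → ℕ
    colour-sym : ∀ u v → colour u v ≡ colour v u

  -- Each edge {u , v} is listed once, as the pair with u < v.
  edges : List (Fin n × Fin n)
  edges = filter (λ (u , v) → (u <? v) ×-dec adj? u v)
                 (cartesianProduct (allFin n) (allFin n))

  e : ℕ
  e = length edges

  c : ℕ
  c = length (deduplicate _≟_ (map (uncurry colour) edges))

  Complete : Set
  Complete = ∀ {u v} → u ≢ v → Adj u v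

open EdgeColouredGraph public using (e; c; Complete)

-- Vertices are indexed from 0, so v_{i+1} is i : Fin N, and the edge between
-- i and j has colour min(i , j) + 1.
T : (N : ℕ) → EdgeColouredGraph N
T N = record
  { Adj        = _≢_
  ; adj?       = λ u v → ¬? (u ≟ᶠ v)
  ; adj-sym    = ≢-sym
  ; adj-irrefl = λ u≡v u≢v → u≢v u≡v
  ; colour     = λ i j → suc (toℕ i ⊓ toℕ j)
  ; colour-sym = λ i j → cong suc (⊓-comm (toℕ i) (toℕ j))
  }

record Copy {k n : ℕ} (F : EdgeColouredGraph k) (G : EdgeColouredGraph n) : Set where
  private
    module F = EdgeColouredGraph F
    module G = EdgeColouredGraph G
  field
    φ           : Fin k → Fin n
    injective   : Injective _≡_ _≡_ φ
    adjacent    : ∀ {i j} → F.Adj i j → G.Adj (φ i) (φ j)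
    colour-pres : ∀ {i j} → F.Adj i j → G.colour (φ i) (φ j) ≡ F.colour i j

  EdgeOfCopy : Fin n → Fin n → Set
  EdgeOfCopy u v = ∃₂ λ i j → F.Adj i j × φ i ≡ u × φ j ≡ v

SameEdge : ∀ {n} → (u v x y : Fin n) → Set
SameEdge u v x y = (u ≡ x × v ≡ y) ⊎ (u ≡ y × v ≡ x)

-- For m ≤ n the order suc (n ∸ m) is n - m + 1.
record IsConstruction (m : ℕ) {n : ℕ} (G : EdgeColouredGraph n) : Set where
  open EdgeColouredGraph G using (Adj; colour)
  field
    complete : Complete G
    copy     : Copy (T (suc (n ∸ m))) G
    unique   : ∀ {u v} → Adj u v → ¬ Copy.EdgeOfCopy copy u v →
               ∀ {x y} → Adj x y → colour u v ≡ colour x y → SameEdge u v x y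

record RainbowTriangle {n : ℕ} (G : EdgeColouredGraph n) : Set where
  open EdgeColouredGraph G using (Adj; colour)
  field
    x y z : Fin n
    xy    : Adj x y
    yz    : Adj y z
    xz    : Adj x z
    xy≢yz : colour x y ≢ colour y z
    xy≢xz : colour x y ≢ colour x z
    yz≢xz : colour y z ≢ colour x z

  vertices : List (Fin n)
  vertices = x ∷ y ∷ z ∷ []

open RainbowTriangle public using (vertices)

ContainsProperK₃s : (m : ℕ) {n : ℕ} → EdgeColouredGraph n → Set
ContainsProperK₃s m G =
  Σ[ t ∈ (Fin m → RainbowTriangle G) ]
    (∀ {i j} → i ≢ j → Disjoint (vertices (t i)) (vertices (t j)))

{-# OPTIONS --safe #-}
module Submission where

-- Any triangle inside T sees the smallest of its three indices on two of its
-- edges, so it is not rainbow: every rainbow triangle of G uses one of the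
-- m − 1 vertices outside the copy of T, and m of them cannot be disjoint.
-- The colours are the n − m colours of T together with one for each of the
-- C(n,2) − C(n−m+1,2) remaining edges.

open import Data.Nat.Base using (ℕ; _+_; _*_; _∸_; _≤_; _<_; _>_; _≥_)
open import Data.Nat.Combinatorics using (_C_)
open import Data.Product.Base using (_×_)
open import Relation.Binary.PropositionalEquality using (_≡_)
open import Relation.Nullary using (¬_)
open import Defs

open import Data.Fin.Base as Fin using (Fin; zero; suc; toℕ; fromℕ; fromℕ<; inject≤; combine; splitAt)
import Data.Fin.Properties as Fin
open import Data.List.Base
  using (List; []; _∷_; _++_; map; filter; length; allFin; upTo; cartesianProduct; deduplicate)
open import Data.List.Membership.Propositional using (_∈_)
open import Data.List.Membership.Propositional.Properties
open import Data.List.Membership.Propositional.Properties.WithK using (unique∧set⇒bag)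
open import Data.List.Properties using (length-map; length-++; length-upTo; length-tabulate)
open import Data.List.Relation.Binary.BagAndSetEquality using (∼bag⇒↭)
open import Data.List.Relation.Binary.Permutation.Propositional.Properties using (↭-length)
import Data.List.Relation.Unary.All as All
import Data.List.Relation.Unary.All.Properties as All
open import Data.List.Relation.Unary.AllPairs using ([]; _∷_)
open import Data.List.Relation.Unary.Any using (here; there)
open import Data.List.Relation.Unary.Unique.DecPropositional.Properties using (deduplicate-!)
open import Data.List.Relation.Unary.Unique.Propositional using (Unique)
import Data.List.Relation.Unary.Unique.Propositional.Properties as Unique
open import Data.Nat.Base using (suc; _⊓_; _⊔_; z≤n; s≤s)
open import Data.Nat.Combinatorics using (nCk+nC[k+1]≡[n+1]C[k+1]; nC1≡n)
import Data.Nat.Properties as ℕ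
open import Data.Nat.Tactic.RingSolver using (solve-∀)
open import Data.Product.Base using (_,_; proj₁; proj₂; ∃; ∃₂; uncurry)
open import Data.Sum.Base using (_⊎_; inj₁; inj₂; [_,_]′)
open import Function.Base using (_∘_; case_of_)
open import Function.Bundles using (mk⇔)
open import Function.Definitions using (Injective)
open import Relation.Binary.Definitions using (Decidable; tri<; tri≈; tri>)
open import Relation.Binary.PropositionalEquality
  using (_≢_; refl; sym; trans; cong; cong₂; subst; subst₂; ≢-sym; module ≡-Reasoning)
open import Relation.Nullary using (yes; no; contradiction)
open import Relation.Nullary.Decidable using (¬?; _×-dec_)

private variable
  A B : Set
  n : ℕ

-- Duplicate-free lists

-- In a duplicate-free list each element has only one membership proof, so equality as sets is
-- equality as bags, that is, up to permutation. Every count of edges or colours below goes through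
-- this: an explicit duplicate-free list with the same elements is measured instead.
unique-sameElements⇒length≡ : {xs ys : List A} → Unique xs → Unique ys →
  (∀ {z} → z ∈ xs → z ∈ ys) → (∀ {z} → z ∈ ys → z ∈ xs) → length xs ≡ length ys
unique-sameElements⇒length≡ xs! ys! to from =
  ↭-length (∼bag⇒↭ (unique∧set⇒bag xs! ys! (mk⇔ to from)))

-- Injectivity is asked on the listed elements only: sorting the images under `φ` is injective on
-- ascending pairs, and `colour` on edges outside the copy, but neither on all pairs.
map⁺-injectiveOn : (f : A → B) {xs : List A} →
  (∀ {x y} → x ∈ xs → y ∈ xs → f x ≡ f y → x ≡ y) → Unique xs → Unique (map f xs)
map⁺-injectiveOn f inj []         = []
map⁺-injectiveOn f inj (x∉ ∷ xs!) =
  All.map⁺ (All.tabulate λ y∈ fx≡fy → All.lookup x∉ y∈ (inj (here refl) (there y∈) fx≡fy))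
  ∷ map⁺-injectiveOn f (λ x∈ y∈ → inj (there x∈) (there y∈)) xs!

-- Binomial coefficients

[1+n]C2≡n+nC2 : ∀ n → suc n C 2 ≡ n + n C 2
[1+n]C2≡n+nC2 n = trans (sym (nCk+nC[k+1]≡[n+1]C[k+1] n 1)) (cong (_+ n C 2) (nC1≡n n))

2*[1+n]C2≡[1+n]*n : ∀ n → 2 * (suc n C 2) ≡ suc n * n
2*[1+n]C2≡[1+n]*n ℕ.zero  = refl
2*[1+n]C2≡[1+n]*n (suc n) = begin
  2 * (suc (suc n) C 2)         ≡⟨ cong (2 *_) ([1+n]C2≡n+nC2 (suc n)) ⟩
  2 * (suc n + suc n C 2)       ≡⟨ ℕ.*-distribˡ-+ 2 (suc n) (suc n C 2) ⟩
  2 * suc n + 2 * (suc n C 2)   ≡⟨ cong (2 * suc n +_) (2*[1+n]C2≡[1+n]*n n) ⟩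
  2 * suc n + suc n * n         ≡⟨ ring n ⟩
  suc (suc n) * suc n           ∎
  where
  open ≡-Reasoning
  ring : ∀ n → 2 * suc n + suc n * n ≡ suc (suc n) * suc n
  ring = solve-∀

-- Unordered pairs

-- A normal form for unordered pairs, smaller vertex first as in `edges`: `SameEdge` amounts to
-- equality of normal forms. It also makes the colour code of the extremal graph symmetric.
ordered : Fin n → Fin n → Fin n × Fin n
ordered u v with u Fin.<? v
... | yes _ = u , v
... | no  _ = v , u

ordered-< : {u v : Fin n} → u Fin.< v → ordered u v ≡ (u , v)
ordered-< {u = u} {v} u<v with u Fin.<? v
... | yes _   = refl
... | no  u≮v = contradiction u<v u≮v

ordered-comm : (u v : Fin n) → ordered u v ≡ ordered v u
ordered-comm u v with u Fin.<? v | v Fin.<? u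
... | yes u<v | yes v<u = contradiction v<u (Fin.<-asym u<v)
... | yes _   | no  _   = refl
... | no  _   | yes _   = refl
... | no  u≮v | no  v≮u
  with refl ← Fin.≤-antisym {i = u} {j = v} (ℕ.≮⇒≥ v≮u) (ℕ.≮⇒≥ u≮v) = refl

ordered-sameEdge : (u v : Fin n) → uncurry SameEdge (ordered u v) u v
ordered-sameEdge u v with u Fin.<? v
... | yes _ = inj₁ (refl , refl)
... | no  _ = inj₂ (refl , refl)

ordered-ascending : {u v : Fin n} → u ≢ v → uncurry Fin._<_ (ordered u v)
ordered-ascending {u = u} {v} u≢v with u Fin.<? v
... | yes u<v = u<v
... | no  u≮v = Fin.≤∧≢⇒< (ℕ.≮⇒≥ u≮v) (≢-sym u≢v)

sameEdge-sym : {u v x y : Fin n} → SameEdge u v x y → SameEdge x y u v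
sameEdge-sym (inj₁ (refl , refl)) = inj₁ (refl , refl)
sameEdge-sym (inj₂ (refl , refl)) = inj₂ (refl , refl)

sameEdge-trans : {u v x y a b : Fin n} → SameEdge u v x y → SameEdge x y a b → SameEdge u v a b
sameEdge-trans (inj₁ (refl , refl)) s                    = s
sameEdge-trans (inj₂ (refl , refl)) (inj₁ (refl , refl)) = inj₂ (refl , refl)
sameEdge-trans (inj₂ (refl , refl)) (inj₂ (refl , refl)) = inj₁ (refl , refl)

sameEdge-injective : ∀ {k} {f : Fin k → Fin n} → Injective _≡_ _≡_ f →
  ∀ {i j i′ j′} → SameEdge (f i) (f j) (f i′) (f j′) → SameEdge i j i′ j′
sameEdge-injective inj (inj₁ (p , q)) = inj₁ (inj p , inj q)
sameEdge-injective inj (inj₂ (p , q)) = inj₂ (inj p , inj q)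

sameEdge-cong : ∀ {k} (f : Fin k → Fin n) {i j i′ j′} →
  SameEdge i j i′ j′ → SameEdge (f i) (f j) (f i′) (f j′)
sameEdge-cong f (inj₁ (refl , refl)) = inj₁ (refl , refl)
sameEdge-cong f (inj₂ (refl , refl)) = inj₂ (refl , refl)

sameEdge⇒ordered≡ : {u v x y : Fin n} → SameEdge u v x y → ordered u v ≡ ordered x y
sameEdge⇒ordered≡         (inj₁ (refl , refl)) = refl
sameEdge⇒ordered≡ {u = u} (inj₂ (refl , refl)) = ordered-comm u _

ordered≡⇒sameEdge : {u v x y : Fin n} → ordered u v ≡ ordered x y → SameEdge u v x y
ordered≡⇒sameEdge {u = u} {v} {x} {y} eq = sameEdge-trans
  (sameEdge-sym (ordered-sameEdge u v))
  (subst (λ p → uncurry SameEdge p x y) (sym eq) (ordered-sameEdge x y))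

sameEdge∧ascending⇒≡ : {u v x y : Fin n} → u Fin.< v → x Fin.< y →
  SameEdge u v x y → (u , v) ≡ (x , y)
sameEdge∧ascending⇒≡ u<v x<y s =
  trans (sym (ordered-< u<v)) (trans (sameEdge⇒ordered≡ s) (ordered-< x<y))

-- Edges of a complete graph

-- A model of the edge list of a complete graph, split by whether vertex `zero` is used, so that its
-- length follows Pascal's recurrence. The filtered product `edges` has no such recursive shape.
ascendingPairs : ∀ n → List (Fin n × Fin n)
ascendingPairs ℕ.zero  = []
ascendingPairs (suc n) =
  map (λ j → zero , suc j) (allFin n) ++ map (λ (i , j) → suc i , suc j) (ascendingPairs n)

∈-ascendingPairs⁺ : {u v : Fin n} → u Fin.< v → (u , v) ∈ ascendingPairs n
∈-ascendingPairs⁺ {u = zero}  {suc v} _         = ∈-++⁺ˡ (∈-map⁺ _ (∈-allFin v))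
∈-ascendingPairs⁺ {u = suc u} {suc v} (s≤s u<v) = ∈-++⁺ʳ _ (∈-map⁺ _ (∈-ascendingPairs⁺ u<v))

∈-ascendingPairs⁻ : ∀ n {p} → p ∈ ascendingPairs n → uncurry Fin._<_ p
∈-ascendingPairs⁻ (suc n) p∈ with ∈-++⁻ (map _ (allFin n)) p∈
... | inj₁ p∈ˡ with _ , _ , refl ← ∈-map⁻ _ p∈ˡ = s≤s z≤n
... | inj₂ p∈ʳ with _ , q∈ , refl ← ∈-map⁻ _ p∈ʳ = s≤s (∈-ascendingPairs⁻ n q∈)

ascendingPairs-unique : ∀ n → Unique (ascendingPairs n)
ascendingPairs-unique ℕ.zero  = []
ascendingPairs-unique (suc n) = Unique.++⁺
  (Unique.map⁺ (λ { refl → refl }) (Unique.allFin⁺ n))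
  (Unique.map⁺ (λ { refl → refl }) (ascendingPairs-unique n))
  (λ (p∈ˡ , p∈ʳ) → case ∈-map⁻ _ p∈ˡ , ∈-map⁻ _ p∈ʳ of λ { ((_ , _ , refl) , (_ , _ , ())) })

length-ascendingPairs : ∀ n → length (ascendingPairs n) ≡ n C 2
length-ascendingPairs ℕ.zero  = refl
length-ascendingPairs (suc n) = begin
  length (ascendingPairs (suc n))
    ≡⟨ length-++ (map _ (allFin n)) ⟩
  length (map _ (allFin n)) + length (map _ (ascendingPairs n))
    ≡⟨ cong₂ _+_ (length-map _ (allFin n)) (length-map _ (ascendingPairs n)) ⟩
  length (allFin n) + length (ascendingPairs n)
    ≡⟨ cong₂ _+_ (length-tabulate {n = n} (λ i → i)) (length-ascendingPairs n) ⟩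
  n + n C 2
    ≡⟨ [1+n]C2≡n+nC2 n ⟨
  suc n C 2 ∎
  where open ≡-Reasoning

module _ (G : EdgeColouredGraph n) where
  open EdgeColouredGraph G hiding (e; c; Complete)

  ∈-edges⁺ : ∀ {u v} → u Fin.< v → Adj u v → (u , v) ∈ edges
  ∈-edges⁺ {u} {v} u<v uv =
    ∈-filter⁺ _ (∈-cartesianProduct⁺ (∈-allFin u) (∈-allFin v)) (u<v , uv)

  ∈-edges⁻ : ∀ {u v} → (u , v) ∈ edges → u Fin.< v × Adj u v
  ∈-edges⁻ p∈ = proj₂ (∈-filter⁻ _ {xs = cartesianProduct (allFin n) (allFin n)} p∈)

  edges-unique : Unique edges
  edges-unique = Unique.filter⁺ _ (Unique.cartesianProduct⁺ (Unique.allFin⁺ n) (Unique.allFin⁺ n))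

  complete⇒e≡nC2 : Complete G → e G ≡ n C 2
  complete⇒e≡nC2 complete = trans
    (unique-sameElements⇒length≡ edges-unique (ascendingPairs-unique n)
      (λ p∈ → ∈-ascendingPairs⁺ (proj₁ (∈-edges⁻ p∈)))
      (λ p∈ → let u<v = ∈-ascendingPairs⁻ n p∈ in ∈-edges⁺ u<v (complete (Fin.<⇒≢ u<v))))
    (length-ascendingPairs n)

  colour-sameEdge : ∀ {u v x y} → SameEdge u v x y → colour u v ≡ colour x y
  colour-sameEdge (inj₁ (refl , refl)) = refl
  colour-sameEdge (inj₂ (refl , refl)) = colour-sym _ _

-- Colours of `T` as minima of indices

-- The smaller index lies strictly below the other, which is at most `n`. Hence `T (suc n)` uses no
-- colour beyond `n`.
i≢j⇒i⊓j<n : {i j : Fin (suc n)} → i ≢ j → toℕ i ⊓ toℕ j < n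
i≢j⇒i⊓j<n {i = i} {j} i≢j with ℕ.<-cmp (toℕ i) (toℕ j)
... | tri< i<j _ _ = ℕ.≤-<-trans (ℕ.m⊓n≤m _ _) (ℕ.<-≤-trans i<j (Fin.toℕ≤pred[n] j))
... | tri≈ _ i≡j _ = contradiction (Fin.toℕ-injective i≡j) i≢j
... | tri> _ _ j<i = ℕ.≤-<-trans (ℕ.m⊓n≤n _ _) (ℕ.<-≤-trans j<i (Fin.toℕ≤pred[n] i))

-- The least of the three numbers is the minimum of both pairs that contain it.
two-pairwise-minima-agree : ∀ a b c → a ⊓ b ≡ b ⊓ c ⊎ a ⊓ b ≡ a ⊓ c ⊎ b ⊓ c ≡ a ⊓ c
two-pairwise-minima-agree a b c with ℕ.≤-total a b | ℕ.≤-total b c | ℕ.≤-total a c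
... | inj₁ a≤b | _        | inj₁ a≤c = inj₂ (inj₁ (trans (ℕ.m≤n⇒m⊓n≡m a≤b) (sym (ℕ.m≤n⇒m⊓n≡m a≤c))))
... | inj₂ b≤a | inj₁ b≤c | _        = inj₁ (trans (ℕ.m≥n⇒m⊓n≡n b≤a) (sym (ℕ.m≤n⇒m⊓n≡m b≤c)))
... | _        | inj₂ c≤b | inj₂ c≤a = inj₂ (inj₂ (trans (ℕ.m≥n⇒m⊓n≡n c≤b) (sym (ℕ.m≥n⇒m⊓n≡n c≤a))))
-- The three comparisons are made independently, so the two cyclic outcomes remain; transitivity
-- reduces each to a case with a known least element.
... | inj₁ a≤b | inj₁ b≤c | inj₂ c≤a = inj₂ (inj₁ (trans (ℕ.m≤n⇒m⊓n≡m a≤b) (sym (ℕ.m≤n⇒m⊓n≡m (ℕ.≤-trans a≤b b≤c)))))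
... | inj₂ b≤a | inj₂ c≤b | inj₁ a≤c = inj₂ (inj₂ (trans (ℕ.m≥n⇒m⊓n≡n c≤b) (sym (ℕ.m≥n⇒m⊓n≡n (ℕ.≤-trans c≤b b≤a)))))

-- The construction

module _ {m n : ℕ} {G : EdgeColouredGraph n} (K : IsConstruction m G) where
  open EdgeColouredGraph G hiding (e; c; Complete)
  open IsConstruction K
  open Copy copy

  private
    k : ℕ
    k = n ∸ m

  edgeOfCopy? : Decidable EdgeOfCopy
  edgeOfCopy? u v = Fin.any? λ i → Fin.any? λ j →
    ¬? (i Fin.≟ j) ×-dec (φ i Fin.≟ u) ×-dec (φ j Fin.≟ v)

  edgeOfCopy-sameEdge : ∀ {u v x y} → SameEdge u v x y → EdgeOfCopy u v → EdgeOfCopy x y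
  edgeOfCopy-sameEdge (inj₁ (refl , refl)) uv                    = uv
  edgeOfCopy-sameEdge (inj₂ (refl , refl)) (i , j , i≢j , p , q) = j , i , ≢-sym i≢j , q , p

  -- The images are sorted because `φ` need not preserve the order of the vertices, whereas `edges`
  -- of `G` lists ascending pairs.
  copyEdges : List (Fin n × Fin n)
  copyEdges = map (λ (i , j) → ordered (φ i) (φ j)) (EdgeColouredGraph.edges (T (suc k)))

  otherEdges : List (Fin n × Fin n)
  otherEdges = filter (λ (u , v) → ¬? (edgeOfCopy? u v)) edges

  ∈-otherEdges⁻ : ∀ {u v} → (u , v) ∈ otherEdges → (u Fin.< v × Adj u v) × ¬ EdgeOfCopy u v
  ∈-otherEdges⁻ p∈ with p∈E , p∉C ← ∈-filter⁻ _ {xs = edges} p∈ = ∈-edges⁻ G p∈E , p∉C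

  ∈-copyEdges⁺ : ∀ {u v} → u Fin.< v → EdgeOfCopy u v → (u , v) ∈ copyEdges
  ∈-copyEdges⁺ u<v (i , j , i≢j , refl , refl) = subst (_∈ copyEdges)
    -- The indices `i`, `j` are sorted first to obtain a listed edge of `T`; sorting its image gives
    -- back `(u , v)` since `u<v`.
    (trans (sameEdge⇒ordered≡ (sameEdge-cong φ (ordered-sameEdge i j))) (ordered-< u<v))
    (∈-map⁺ _ (∈-edges⁺ (T (suc k)) i<j (Fin.<⇒≢ i<j)))
    where i<j = ordered-ascending i≢j

  ∈-copyEdges⁻ : ∀ {u v} → (u , v) ∈ copyEdges → u Fin.< v × EdgeOfCopy u v
  ∈-copyEdges⁻ p∈
    with (i , j) , q∈ , eq ← ∈-map⁻ _ p∈
    with i<j , i≢j ← ∈-edges⁻ (T (suc k)) q∈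
    = subst (uncurry Fin._<_) (sym eq) (ordered-ascending (i≢j ∘ injective))
    , edgeOfCopy-sameEdge
        (sameEdge-sym (subst (λ p → uncurry SameEdge p (φ i) (φ j)) (sym eq) (ordered-sameEdge _ _)))
        (i , j , i≢j , refl , refl)

  -- Equal sorted images are the same edge of `G`; injectivity of `φ` pulls this back to `T`, where
  -- an edge has only one ascending form.
  copyEdges-unique : Unique copyEdges
  copyEdges-unique = map⁺-injectiveOn _
    (λ p∈ q∈ eq → sameEdge∧ascending⇒≡
      (proj₁ (∈-edges⁻ (T (suc k)) p∈)) (proj₁ (∈-edges⁻ (T (suc k)) q∈))
      (sameEdge-injective injective (ordered≡⇒sameEdge eq)))
    (edges-unique (T (suc k)))

  length-copyEdges : length copyEdges ≡ suc k C 2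
  length-copyEdges = trans (length-map _ (EdgeColouredGraph.edges (T (suc k))))
                           (complete⇒e≡nC2 (T (suc k)) (λ i≢j → i≢j))

  -- The edges of `G` are partitioned into those of the copy and the rest. The additive form keeps
  -- truncated subtraction out of the count.
  nC2≡[1+k]C2+others : n C 2 ≡ suc k C 2 + length otherEdges
  nC2≡[1+k]C2+others = begin
    n C 2                                  ≡⟨ complete⇒e≡nC2 G complete ⟨
    length edges                           ≡⟨ unique-sameElements⇒length≡ (edges-unique G)
                                                (Unique.++⁺ copyEdges-unique
                                                            (Unique.filter⁺ _ (edges-unique G))
                                                            disjoint)
                                                to from ⟩
    length (copyEdges ++ otherEdges)       ≡⟨ length-++ copyEdges ⟩
    length copyEdges + length otherEdges   ≡⟨ cong (_+ length otherEdges) length-copyEdges ⟩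
    suc k C 2 + length otherEdges          ∎
    where
    open ≡-Reasoning
    disjoint : ∀ {p} → ¬ (p ∈ copyEdges × p ∈ otherEdges)
    disjoint (p∈C , p∈O) = proj₂ (∈-otherEdges⁻ p∈O) (proj₂ (∈-copyEdges⁻ p∈C))

    to : ∀ {p} → p ∈ edges → p ∈ copyEdges ++ otherEdges
    to {u , v} p∈ with edgeOfCopy? u v
    ... | yes p∈C = ∈-++⁺ˡ (∈-copyEdges⁺ (proj₁ (∈-edges⁻ G p∈)) p∈C)
    ... | no  p∉C = ∈-++⁺ʳ copyEdges (∈-filter⁺ _ p∈ p∉C)

    from : ∀ {p} → p ∈ copyEdges ++ otherEdges → p ∈ edges
    from p∈ with ∈-++⁻ copyEdges p∈
    ... | inj₁ p∈C = let u<v , _ = ∈-copyEdges⁻ p∈C in ∈-edges⁺ G u<v (complete (Fin.<⇒≢ u<v))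
    ... | inj₂ p∈O = proj₁ (∈-filter⁻ _ {xs = edges} p∈O)

  -- The colour a + 1 of T_{k+1} appears on the edge joining v_{a+1} to the last vertex.
  copy-colour-used : ∀ {a} → a < k → ∃₂ λ u v → EdgeOfCopy u v × u ≢ v × colour u v ≡ suc a
  copy-colour-used {a} a<k =
    φ i , φ j , (i , j , i≢j , refl , refl) , i≢j ∘ injective , trans (colour-pres i≢j) (cong suc i⊓j≡a)
    where
    a<1+k = ℕ.m<n⇒m<1+n a<k
    i j : Fin (suc k)
    i = fromℕ< a<1+k
    j = fromℕ k
    toℕi<toℕj : toℕ i < toℕ j
    toℕi<toℕj = subst₂ _<_ (sym (Fin.toℕ-fromℕ< a<1+k)) (sym (Fin.toℕ-fromℕ k)) a<k
    i≢j : i ≢ j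
    i≢j = Fin.<⇒≢ toℕi<toℕj
    i⊓j≡a : toℕ i ⊓ toℕ j ≡ a
    i⊓j≡a = trans (ℕ.m≤n⇒m⊓n≡m (ℕ.<⇒≤ toℕi<toℕj)) (Fin.toℕ-fromℕ< a<1+k)

  -- The copy shows exactly the colours `1` to `k`. By `unique`, the other edges have pairwise
  -- different colours, none of them shared with the copy.
  c≡k+others : c G ≡ k + length otherEdges
  c≡k+others = begin
    c G
      ≡⟨ unique-sameElements⇒length≡
           (deduplicate-! ℕ._≟_ (map (uncurry colour) edges))
           (Unique.++⁺ (Unique.map⁺ ℕ.suc-injective (Unique.upTo⁺ k)) otherColours-unique disjoint)
           to from ⟩
    length (copyColours ++ otherColours)
      ≡⟨ length-++ copyColours ⟩
    length copyColours + length otherColours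
      ≡⟨ cong₂ _+_ (length-map suc (upTo k)) (length-map _ otherEdges) ⟩
    length (upTo k) + length otherEdges
      ≡⟨ cong (_+ length otherEdges) (length-upTo k) ⟩
    k + length otherEdges ∎
    where
    open ≡-Reasoning
    copyColours otherColours : List ℕ
    copyColours  = map suc (upTo k)
    otherColours = map (uncurry colour) otherEdges

    otherColours-unique : Unique otherColours
    otherColours-unique = map⁺-injectiveOn _
      (λ p∈ q∈ eq →
        let (u<v , uv) , uv∉C = ∈-otherEdges⁻ p∈
            (x<y , xy) , _    = ∈-otherEdges⁻ q∈
        in sameEdge∧ascending⇒≡ u<v x<y (unique uv uv∉C xy eq))
      (Unique.filter⁺ _ (edges-unique G))

    disjoint : ∀ {z} → ¬ (z ∈ copyColours × z ∈ otherColours)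
    disjoint (z∈C , z∈O)
      with a , a∈ , refl ← ∈-map⁻ suc z∈C
         | (u , v) , p∈ , eq ← ∈-map⁻ _ z∈O
      with x , y , xy∈C , x≢y , xy≡ ← copy-colour-used (∈-upTo⁻ a∈)
         | (_ , uv) , uv∉C ← ∈-otherEdges⁻ p∈
      -- The shared colour `suc a` also sits on the copy edge `x`, `y`; `unique` then identifies
      -- that edge with `u`, `v`, which was outside the copy.
      = uv∉C (edgeOfCopy-sameEdge
               (sameEdge-sym (unique uv uv∉C (complete x≢y) (trans (sym eq) (sym xy≡)))) xy∈C)

    to : ∀ {z} → z ∈ deduplicate ℕ._≟_ (map (uncurry colour) edges) → z ∈ copyColours ++ otherColours
    to z∈
      with (u , v) , p∈ , refl ← ∈-map⁻ _ (∈-deduplicate⁻ ℕ._≟_ (map (uncurry colour) edges) z∈)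
      with edgeOfCopy? u v
    ... | yes (i , j , i≢j , refl , refl) = ∈-++⁺ˡ
      (subst (_∈ copyColours) (sym (colour-pres i≢j)) (∈-map⁺ suc (∈-upTo⁺ (i≢j⇒i⊓j<n i≢j))))
    ... | no  p∉C = ∈-++⁺ʳ copyColours (∈-map⁺ _ (∈-filter⁺ _ p∈ p∉C))

    from : ∀ {z} → z ∈ copyColours ++ otherColours → z ∈ deduplicate ℕ._≟_ (map (uncurry colour) edges)
    from z∈ = ∈-deduplicate⁺ ℕ._≟_ (case ∈-++⁻ copyColours z∈ of λ where
      (inj₁ z∈C) →
        let a , a∈ , z≡ = ∈-map⁻ suc z∈C
            x , y , _ , x≢y , xy≡ = copy-colour-used (∈-upTo⁻ a∈)
            x<y = ordered-ascending x≢y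
        in subst (_∈ map (uncurry colour) edges)
             (trans (colour-sameEdge G (ordered-sameEdge x y)) (trans xy≡ (sym z≡)))
             (∈-map⁺ _ (∈-edges⁺ G x<y (complete (Fin.<⇒≢ x<y))))
      (inj₂ z∈O) →
        let p , p∈ , z≡ = ∈-map⁻ _ z∈O
        in subst (_∈ map (uncurry colour) edges) (sym z≡)
             (∈-map⁺ _ (proj₁ (∈-filter⁻ _ {xs = edges} p∈))))

  rainbowTriangle-leaves-copy : (t : RainbowTriangle G) →
    ∃ λ v → v ∈ vertices t × (∀ i → φ i ≢ v)
  rainbowTriangle-leaves-copy t
    with Fin.any? (λ i → φ i Fin.≟ RainbowTriangle.x t)
       | Fin.any? (λ i → φ i Fin.≟ RainbowTriangle.y t)
       | Fin.any? (λ i → φ i Fin.≟ RainbowTriangle.z t)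
  ... | no x∉ | _     | _     = _ , here refl , λ i eq → x∉ (i , eq)
  ... | _     | no y∉ | _     = _ , there (here refl) , λ i eq → y∉ (i , eq)
  ... | _     | _     | no z∉ = _ , there (there (here refl)) , λ i eq → z∉ (i , eq)
  ... | yes (h , refl) | yes (i , refl) | yes (j , refl) =
    case two-pairwise-minima-agree (toℕ h) (toℕ i) (toℕ j) of λ where
      (inj₁ eq)        → contradiction (agree xy yz eq) xy≢yz
      (inj₂ (inj₁ eq)) → contradiction (agree xy xz eq) xy≢xz
      (inj₂ (inj₂ eq)) → contradiction (agree yz xz eq) yz≢xz
    where
    open RainbowTriangle t using (xy; yz; xz; xy≢yz; xy≢xz; yz≢xz)
    -- `colour-pres` speaks of distinct indices only; distinctness is recovered from irreflexivity
    -- of adjacency in `G`.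
    distinct : ∀ {i j} → Adj (φ i) (φ j) → i ≢ j
    distinct uv refl = adj-irrefl refl uv
    agree : ∀ {a b c d} → Adj (φ a) (φ b) → Adj (φ c) (φ d) →
      toℕ a ⊓ toℕ b ≡ toℕ c ⊓ toℕ d → colour (φ a) (φ b) ≡ colour (φ c) (φ d)
    agree ab cd eq = trans (colour-pres (distinct ab))
                           (trans (cong suc eq) (sym (colour-pres (distinct cd))))

  -- Only m − 1 vertices lie outside the copy: choosing one from each of m disjoint
  -- rainbow triangles would give n + 1 distinct vertices together with the copy.
  construction-no-properK₃s : n ≥ m → ¬ ContainsProperK₃s m G
  construction-no-properK₃s m≤n (t , disjoint) =
    ℕ.<-irrefl refl (subst (_≤ n) m+1+k≡1+n (Fin.injective⇒≤ g-injective))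
    where
    m+1+k≡1+n : m + suc k ≡ suc n
    m+1+k≡1+n = trans (ℕ.+-suc m k) (cong suc (ℕ.m+[n∸m]≡n m≤n))

    outside : Fin m → Fin n
    outside a = proj₁ (rainbowTriangle-leaves-copy (t a))

    outside∈ : ∀ a → outside a ∈ vertices (t a)
    outside∈ a = proj₁ (proj₂ (rainbowTriangle-leaves-copy (t a)))

    outside∉copy : ∀ a i → φ i ≢ outside a
    outside∉copy a = proj₂ (proj₂ (rainbowTriangle-leaves-copy (t a)))

    outside-injective : Injective _≡_ _≡_ outside
    outside-injective {a} {b} eq with a Fin.≟ b
    ... | yes a≡b = a≡b
    ... | no  a≢b = contradiction
      (outside∈ a , subst (_∈ vertices (t b)) (sym eq) (outside∈ b)) (disjoint a≢b)

    sum-injective : Injective _≡_ _≡_ [ outside , φ ]′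
    sum-injective {inj₁ a} {inj₁ b} eq = cong inj₁ (outside-injective eq)
    sum-injective {inj₁ a} {inj₂ i} eq = contradiction (sym eq) (outside∉copy a i)
    sum-injective {inj₂ i} {inj₁ a} eq = contradiction eq (outside∉copy a i)
    sum-injective {inj₂ i} {inj₂ j} eq = cong inj₂ (injective eq)

    g : Fin (m + suc k) → Fin n
    g = [ outside , φ ]′ ∘ splitAt m

    g-injective : Injective _≡_ _≡_ g
    g-injective {p} {q} eq = begin
      p                                   ≡⟨ Fin.join-splitAt m (suc k) p ⟨
      Fin.join m (suc k) (splitAt m p)    ≡⟨ cong (Fin.join m (suc k)) (sum-injective {splitAt m p} {splitAt m q} eq) ⟩
      Fin.join m (suc k) (splitAt m q)    ≡⟨ Fin.join-splitAt m (suc k) q ⟩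
      q                                   ∎
      where open ≡-Reasoning

-- Closed forms for the colour and edge counts

-- Doubling turns the binomial coefficients into polynomials.
count-identity : ∀ m k r → suc m + k ≡ n → n C 2 ≡ suc k C 2 + r →
  (k + r) + ((suc m + 1) C 2) ≡ suc m * n
count-identity m k r refl eq rewrite ℕ.+-comm m 1 =
  -- The summand `suc k * k` is twice `suc k C 2`. Adding it to both sides completes `r` to
  -- `suc k C 2 + r`, which `eq` turns into `n C 2`.
  ℕ.*-cancelˡ-≡ _ _ 2 (ℕ.+-cancelʳ-≡ (suc k * k) _ _ (begin
    2 * (k + r + D) + suc k * k
      ≡⟨ cong (2 * (k + r + D) +_) (2*[1+n]C2≡[1+n]*n k) ⟨
    2 * (k + r + D) + 2 * (suc k C 2)
      ≡⟨ regroup k r D (suc k C 2) ⟩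
    2 * k + 2 * (suc k C 2 + r) + 2 * D
      ≡⟨ cong (λ s → 2 * k + 2 * s + 2 * D) eq ⟨
    2 * k + 2 * (suc (m + k) C 2) + 2 * D
      ≡⟨ cong₂ (λ s t → 2 * k + s + t) (2*[1+n]C2≡[1+n]*n (m + k)) (2*[1+n]C2≡[1+n]*n (suc m)) ⟩
    2 * k + suc (m + k) * (m + k) + suc (suc m) * suc m
      ≡⟨ ring m k ⟩
    2 * (suc m * (suc m + k)) + suc k * k ∎))
  where
  open ≡-Reasoning
  D = suc (suc m) C 2
  regroup : ∀ k r d s → 2 * (k + r + d) + 2 * s ≡ 2 * k + 2 * (s + r) + 2 * d
  regroup = solve-∀
  ring : ∀ m k → 2 * k + suc (m + k) * (m + k) + suc (suc m) * suc m
               ≡ 2 * (suc m * (suc m + k)) + suc k * k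
  ring = solve-∀

-- Besides giving the value of `c G`, this form shows that the binomial coefficient is at most
-- `m * n`, so the subtractions in the two closed forms below do not truncate.
c+[m+1]C2≡m*n : ∀ {m n} {G : EdgeColouredGraph n} → m ≥ 1 → n ≥ m → IsConstruction m G →
  c G + ((m + 1) C 2) ≡ m * n
c+[m+1]C2≡m*n {m = suc m} {n} 1≤m m≤n K = trans (cong (_+ ((suc m + 1) C 2)) (c≡k+others K))
  (count-identity m (n ∸ suc m) (length (otherEdges K)) (ℕ.m+[n∸m]≡n m≤n) (nC2≡[1+k]C2+others K))

construction-c : ∀ {m n} {G : EdgeColouredGraph n} → m ≥ 1 → n ≥ m → IsConstruction m G →
  c G ≡ m * n ∸ ((m + 1) C 2)
construction-c {m} {G = G} 1≤m m≤n K = trans (sym (ℕ.m+n∸n≡m (c G) ((m + 1) C 2)))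
  (cong (_∸ ((m + 1) C 2)) (c+[m+1]C2≡m*n 1≤m m≤n K))

construction-e+c : ∀ {m n} {G : EdgeColouredGraph n} → m ≥ 1 → n ≥ m → IsConstruction m G →
  e G + c G ≡ (n C 2) + m * n ∸ ((m + 1) C 2)
construction-e+c {m} {n} {G} 1≤m m≤n K = begin
  e G + c G                              ≡⟨ cong₂ _+_ (complete⇒e≡nC2 G (IsConstruction.complete K))
                                                      (construction-c 1≤m m≤n K) ⟩
  (n C 2) + (m * n ∸ ((m + 1) C 2))      ≡⟨ ℕ.+-∸-assoc (n C 2)
                                              (subst ((m + 1) C 2 ≤_) (c+[m+1]C2≡m*n 1≤m m≤n K)
                                                     (ℕ.m≤n+m ((m + 1) C 2) (c G))) ⟨
  (n C 2) + m * n ∸ ((m + 1) C 2)        ∎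
  where open ≡-Reasoning

-- An instance of the construction

module _ {m n : ℕ} (1≤m : 1 ≤ m) (m≤n : m ≤ n) where
  private
    k : ℕ
    k = n ∸ m

    1+k≤n : suc k ≤ n
    1+k≤n = subst (suc k ≤_) (ℕ.m+[n∸m]≡n m≤n) (ℕ.+-monoˡ-≤ k 1≤m)

  -- The copy of T occupies the vertices 0, …, k and uses the colours 1, …, k;
  -- all other colours exceed n.
  extremalColour : Fin n → Fin n → ℕ
  extremalColour u v with toℕ u ⊔ toℕ v ℕ.<? suc k
  ... | yes _ = suc (toℕ u ⊓ toℕ v)
  -- `combine` numbers the pairs injectively, so distinct edges receive distinct codes; the shift by
  -- `suc n` lifts the codes above the colours of the copy.
  ... | no  _ = suc (n + toℕ (uncurry combine (ordered u v)))

  extremalColour-sym : ∀ u v → extremalColour u v ≡ extremalColour v u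
  extremalColour-sym u v with toℕ u ⊔ toℕ v ℕ.<? suc k | toℕ v ⊔ toℕ u ℕ.<? suc k
  ... | yes _    | yes _    = cong suc (ℕ.⊓-comm (toℕ u) (toℕ v))
  ... | no  _    | no  _    = cong (λ p → suc (n + toℕ (uncurry combine p))) (ordered-comm u v)
  ... | yes u⊔v< | no  v⊔u≮ = contradiction (subst (_< suc k) (ℕ.⊔-comm (toℕ u) (toℕ v)) u⊔v<) v⊔u≮
  ... | no  u⊔v≮ | yes v⊔u< = contradiction (subst (_< suc k) (ℕ.⊔-comm (toℕ v) (toℕ u)) v⊔u<) u⊔v≮

  extremal : EdgeColouredGraph n
  extremal = record
    { Adj        = _≢_
    ; adj?       = λ u v → ¬? (u Fin.≟ v)
    ; adj-sym    = ≢-sym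
    ; adj-irrefl = λ u≡v u≢v → u≢v u≡v
    ; colour     = extremalColour
    ; colour-sym = extremalColour-sym
    }

  extremal-copy : Copy (T (suc k)) extremal
  extremal-copy = record
    { φ           = λ i → inject≤ i 1+k≤n
    ; injective   = Fin.inject≤-injective 1+k≤n 1+k≤n _ _
    ; adjacent    = λ i≢j → i≢j ∘ Fin.inject≤-injective 1+k≤n 1+k≤n _ _
    ; colour-pres = λ {i} {j} _ → colour-pres i j
    }
    where
    inject<1+k : ∀ i → toℕ (inject≤ i 1+k≤n) < suc k
    inject<1+k i = subst (_< suc k) (sym (Fin.toℕ-inject≤ i 1+k≤n)) (Fin.toℕ<n i)

    colour-pres : ∀ i j → extremalColour (inject≤ i 1+k≤n) (inject≤ j 1+k≤n) ≡ suc (toℕ i ⊓ toℕ j)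
    colour-pres i j
      with toℕ (inject≤ i 1+k≤n) ⊔ toℕ (inject≤ j 1+k≤n) ℕ.<? suc k
    ... | yes _    = cong suc (cong₂ _⊓_ (Fin.toℕ-inject≤ i 1+k≤n) (Fin.toℕ-inject≤ j 1+k≤n))
    ... | no  i⊔j≮ = contradiction (ℕ.⊔-lub (inject<1+k i) (inject<1+k j)) i⊔j≮

  -- Used by contraposition: an edge outside the copy has an endpoint beyond `k`, and therefore
  -- falls into the second case of `extremalColour`.
  extremal-edgeOfCopy : ∀ {u v} → u ≢ v → toℕ u ⊔ toℕ v < suc k → Copy.EdgeOfCopy extremal-copy u v
  extremal-edgeOfCopy {u} {v} u≢v u⊔v<1+k =
    fromℕ< u< , fromℕ< v<
    , (λ eq → u≢v (trans (sym (back u<)) (trans (cong (λ i → inject≤ i 1+k≤n) eq) (back v<))))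
    , back u< , back v<
    where
    u< = ℕ.m⊔n<o⇒m<o (toℕ u) (toℕ v) u⊔v<1+k
    v< = ℕ.m⊔n<o⇒n<o (toℕ u) (toℕ v) u⊔v<1+k
    back : ∀ {w : Fin n} (w< : toℕ w < suc k) → inject≤ (fromℕ< w<) 1+k≤n ≡ w
    back w< = Fin.toℕ-injective (trans (Fin.toℕ-inject≤ _ 1+k≤n) (Fin.toℕ-fromℕ< w<))

  -- A colour outside the copy has the form `suc (n + code)`. Colours in the first case are at most
  -- `n`, so they cannot match it; equal codes give equal sorted pairs, hence the same edge.
  extremal-unique : ∀ {u v} → u ≢ v → ¬ Copy.EdgeOfCopy extremal-copy u v →
    ∀ {x y} → x ≢ y → extremalColour u v ≡ extremalColour x y → SameEdge u v x y
  extremal-unique {u} {v} u≢v uv∉C {x} {y} x≢y eq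
    with toℕ u ⊔ toℕ v ℕ.<? suc k | toℕ x ⊔ toℕ y ℕ.<? suc k
  ... | yes u⊔v< | _     = contradiction (extremal-edgeOfCopy u≢v u⊔v<) uv∉C
  ... | no  _    | yes _ = contradiction
    (ℕ.≤-<-trans (ℕ.m≤m+n n _)
      (subst (_< n) (sym (ℕ.suc-injective eq)) (ℕ.≤-<-trans (ℕ.m⊓n≤m (toℕ x) (toℕ y)) (Fin.toℕ<n x))))
    (ℕ.<-irrefl refl)
  ... | no  _    | no  _ = ordered≡⇒sameEdge
    (let p , q = Fin.combine-injective _ _ _ _ (Fin.toℕ-injective (ℕ.+-cancelˡ-≡ n _ _ (ℕ.suc-injective eq)))
     in cong₂ _,_ p q)

  extremal-isConstruction : IsConstruction m extremal
  extremal-isConstruction = record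
    { complete = λ u≢v → u≢v
    ; copy     = extremal-copy
    ; unique   = extremal-unique
    }

-- The numerical comparison and the refutation

-- With m = 2 + a and n = 5m + b, twice the difference of the two sides is
-- 2 + 13a + 9a² + 2b + 2ab.
n+6m+[m+1]C2≤mn+6 : ∀ {m n} → m > 1 → n ≥ 5 * m → n + 6 * m + ((m + 1) C 2) ≤ m * n + 6
n+6m+[m+1]C2≤mn+6 {suc (suc a)} (s≤s (s≤s z≤n)) 5m≤n
  with b , refl ← ℕ.m≤n⇒∃[o]m+o≡n 5m≤n
  rewrite ℕ.+-comm a 1 = ℕ.*-cancelˡ-≤ 2 (begin
    2 * (5m + b + 6 * m + D)
      ≡⟨ ℕ.*-distribˡ-+ 2 (5m + b + 6 * m) D ⟩
    2 * (5m + b + 6 * m) + 2 * D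
      ≡⟨ cong (2 * (5m + b + 6 * m) +_) (2*[1+n]C2≡[1+n]*n m) ⟩
    2 * (5m + b + 6 * m) + suc m * m
      ≤⟨ ℕ.m≤m+n _ (2 + 13 * a + 9 * (a * a) + 2 * b + 2 * (a * b)) ⟩
    2 * (5m + b + 6 * m) + suc m * m + (2 + 13 * a + 9 * (a * a) + 2 * b + 2 * (a * b))
      ≡⟨ ring a b ⟩
    2 * (m * (5m + b) + 6) ∎)
  where
  open ℕ.≤-Reasoning
  m = suc (suc a)
  5m = 5 * m
  D = suc m C 2
  ring : ∀ a b → 2 * (5 * suc (suc a) + b + 6 * suc (suc a)) + suc (suc (suc a)) * suc (suc a)
                 + (2 + 13 * a + 9 * (a * a) + 2 * b + 2 * (a * b))
               ≡ 2 * (suc (suc a) * (5 * suc (suc a) + b) + 6)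
  ring = solve-∀

-- Moving both subtractions across and cancelling `n C 2` leaves the previous inequality: its `6` is
-- the `7` less the one that strictness costs.
bound-exceeded : ∀ m n → m > 1 → n ≥ 5 * m →
  (n C 2) + m * n ∸ ((m + 1) C 2) > (n C 2) + n + 6 * m ∸ 7
bound-exceeded m n m>1 n≥5m = ℕ.m+n≤o⇒m≤o∸n (suc (X + n + 6 * m ∸ 7)) (ℕ.+-cancelʳ-≤ 6 _ _ (begin
  suc (X + n + 6 * m ∸ 7) + D + 6     ≡⟨ shift (X + n + 6 * m ∸ 7) D ⟩
  (X + n + 6 * m ∸ 7) + 7 + D         ≡⟨ cong (_+ D) (ℕ.m∸n+n≡m 7≤X+n+6m) ⟩
  X + n + 6 * m + D                   ≡⟨ reassoc X n (6 * m) D ⟩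
  X + (n + 6 * m + D)                 ≤⟨ ℕ.+-monoʳ-≤ X (n+6m+[m+1]C2≤mn+6 m>1 n≥5m) ⟩
  X + (m * n + 6)                     ≡⟨ ℕ.+-assoc X (m * n) 6 ⟨
  X + m * n + 6                       ∎))
  where
  open ℕ.≤-Reasoning
  X = n C 2
  D = (m + 1) C 2
  7≤X+n+6m : 7 ≤ X + n + 6 * m
  -- Here `7 + 5` is `6 * 2`, which is at most `6 * m`; so the subtraction of `7` is exact.
  7≤X+n+6m = ℕ.≤-trans (ℕ.m≤m+n 7 5)
    (ℕ.≤-trans (ℕ.*-monoʳ-≤ 6 m>1) (ℕ.m≤n+m (6 * m) (X + n)))
  shift : ∀ s d → suc s + d + 6 ≡ s + 7 + d
  shift = solve-∀
  reassoc : ∀ x n s d → x + n + s + d ≡ x + (n + s + d)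
  reassoc = solve-∀

-- The assertion fails for each such `m` and `n` separately: `extremal` meets the threshold but has
-- no `m` disjoint rainbow triangles.
extremal-refutes : ∀ m n → m > 1 → n ≥ 5 * m →
  ¬ ((H : EdgeColouredGraph n) → e H + c H ≥ ((n + 1) C 2) + 6 * m ∸ 6 → ContainsProperK₃s m H)
extremal-refutes m n m>1 n≥5m assertion =
  construction-no-properK₃s K m≤n (assertion (extremal 1≤m m≤n) (begin
    ((n + 1) C 2) + 6 * m ∸ 6                ≡⟨ cong (λ s → (s C 2) + 6 * m ∸ 6) (ℕ.+-comm n 1) ⟩
    (suc n C 2) + 6 * m ∸ 6                  ≡⟨ cong (λ s → s + 6 * m ∸ 6)
                                                  (trans ([1+n]C2≡n+nC2 n) (ℕ.+-comm n (n C 2))) ⟩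
    -- The threshold with `6` is at most one above the bound with `7`, and the strict inequality of
    -- `bound-exceeded` supplies that one.
    (n C 2) + n + 6 * m ∸ 6                  ≤⟨ ℕ.m≤n+m∸n _ 1 ⟩
    suc ((n C 2) + n + 6 * m ∸ 6 ∸ 1)        ≡⟨ cong suc (ℕ.∸-+-assoc ((n C 2) + n + 6 * m) 6 1) ⟩
    suc ((n C 2) + n + 6 * m ∸ 7)            ≤⟨ bound-exceeded m n m>1 n≥5m ⟩
    (n C 2) + m * n ∸ ((m + 1) C 2)          ≡⟨ construction-e+c 1≤m m≤n K ⟨
    e (extremal 1≤m m≤n) + c (extremal 1≤m m≤n) ∎))
  where
  open ℕ.≤-Reasoning
  1≤m : 1 ≤ m
  1≤m = ℕ.<⇒≤ m>1
  m≤n : m ≤ n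
  m≤n = ℕ.≤-trans (ℕ.m≤m+n m (4 * m)) n≥5m
  K = extremal-isConstruction 1≤m m≤n

mainTheorem3 : (m n : ℕ) → m ≥ 1 → n ≥ m →
    ((G : EdgeColouredGraph n) → IsConstruction m G →
    (c G ≡ m * n ∸ ((m + 1) C 2))
    × (e G + c G ≡ (n C 2) + m * n ∸ ((m + 1) C 2))
    × (¬ ContainsProperK₃s m G))
    × (m > 1 → n ≥ 5 * m →
    ((n C 2) + m * n ∸ ((m + 1) C 2) > (n C 2) + n + 6 * m ∸ 7)
    × (¬ ((H : EdgeColouredGraph n) →
    e H + c H ≥ ((n + 1) C 2) + 6 * m ∸ 6 →
    ContainsProperK₃s m H)))
mainTheorem3 m n 1≤m m≤n =
  (λ G K → construction-c 1≤m m≤n K , construction-e+c 1≤m m≤n K , construction-no-properK₃s K m≤n) ,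
  (λ m>1 n≥5m → bound-exceeded m n m>1 n≥5m , extremal-refutes m n m>1 n≥5m)
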